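{- Let $F$ be a Sturmian set on an alphabet $A$ with $k$ letters. For any finite $F$-maximal bifix code $X\subset F$, one has $\mathrm{Card}(X)=(k-1)\,d_F(X)+1$.
   Context: For a set $F$ of words and a word $u\in F$, $u$ is right-special if $ua\in F$ for at least two letters $a$. An infinite word $x$ over $A$ is episturmian if its set of factors $F(x)$ is closed under reversal and contains, for each $n\ge1$, at most one right-special word of length $n$; it is strict episturmian if moreover it has exactly one right-special factor of each length and every right-special factor $u$ satisfies $ua\in F(x)$ for all $a\in A$. A Sturmian set is the set of factors of a strict episturmian word. A bifix code is a set of nonempty words none of which is a proper prefix or proper suffix of another; $X\subset F$ is $F$-maximal bifix if not properly contained in a bifix code contained in $F$. A parse of $w$ with respect to $X$ is a triple $(v,x,u)$ with $w=vxu$, $v$ having no suffix in $X$, $x\in X^*$, $u$ having no prefix in $X$; $\delta_X(w)$ is the number of parses, and $d_F(X)=\max_{w\in F}\delta_X(w)$. -}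

module Defs where

open import Data.List.Base using (List; []; _++_; _∷ʳ_; length; reverse; concat; applyUpTo)
open import Data.List.Membership.Propositional using () renaming (_∈_ to _∈ˡ_)
open import Data.List.Relation.Binary.Prefix.Heterogeneous using (Prefix)
open import Data.List.Relation.Binary.Suffix.Heterogeneous using (Suffix)
open import Data.List.Relation.Unary.All using (All)
open import Data.List.Relation.Unary.Unique.Propositional using (Unique)
open import Data.Nat.Base using (ℕ; _+_; _≤_)
open import Data.Product.Base using (∃-syntax; _×_; _,_)
open import Data.Product using (∃!)
open import Level using (0ℓ)
open import Relation.Binary.PropositionalEquality using (_≡_; _≢_)
open import Relation.Nullary.Negation using (¬_)
open import Relation.Unary using (Pred; _∈_; _∉_; _⊆_; _⊂_; _≐_)

HasCard : {B : Set} → Pred B 0ℓ → ℕ → Set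
HasCard P n = ∃[ bs ] Unique bs × (_∈ˡ bs) ≐ P × length bs ≡ n

module _ {A : Set} where

  Word : Set
  Word = List A

  InfiniteWord : Set
  InfiniteWord = ℕ → A

  Language : Set₁
  Language = Pred Word 0ℓ

  Factors : InfiniteWord → Language
  Factors x w = ∃[ i ] ∃[ n ] w ≡ applyUpTo (λ j → x (i + j)) n

  RightSpecial : Language → Pred Word 0ℓ
  RightSpecial F u =
    u ∈ F × ∃[ a ] ∃[ b ] a ≢ b × (u ∷ʳ a) ∈ F × (u ∷ʳ b) ∈ F

  record IsEpisturmian (x : InfiniteWord) : Set where
    field
      reversal-closed : ∀ {w} → w ∈ Factors x → reverse w ∈ Factors x
      atMostOne-rightSpecial : ∀ n → 1 ≤ n → ∀ {u v} →
        length u ≡ n → length v ≡ n →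
        u ∈ RightSpecial (Factors x) → v ∈ RightSpecial (Factors x) → u ≡ v

  record IsStrictEpisturmian (x : InfiniteWord) : Set where
    field
      isEpisturmian : IsEpisturmian x
      exactlyOne-rightSpecial : ∀ n →
        ∃! _≡_ λ u → length u ≡ n × u ∈ RightSpecial (Factors x)
      rightSpecial-full : ∀ {u} → u ∈ RightSpecial (Factors x) →
        ∀ a → (u ∷ʳ a) ∈ Factors x

  IsSturmianSet : Language → Set
  IsSturmianSet F = ∃[ x ] IsStrictEpisturmian x × F ≐ Factors x

  IsPrefixOf IsSuffixOf IsProperPrefixOf IsProperSuffixOf : Word → Word → Set
  IsPrefixOf = Prefix _≡_
  IsSuffixOf = Suffix _≡_
  IsProperPrefixOf u w = IsPrefixOf u w × u ≢ w
  IsProperSuffixOf u w = IsSuffixOf u w × u ≢ w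

  record IsBifixCode (X : Language) : Set where
    field
      nonempty : [] ∉ X
      prefix-free : ∀ {u w} → u ∈ X → w ∈ X → ¬ IsProperPrefixOf u w
      suffix-free : ∀ {u w} → u ∈ X → w ∈ X → ¬ IsProperSuffixOf u w

  record IsMaximalBifixCode (F X : Language) : Set₁ where
    field
      contained : X ⊆ F
      isBifixCode : IsBifixCode X
      maximal : ∀ (Y : Language) → IsBifixCode Y → Y ⊆ F → ¬ (X ⊂ Y)

  Star : Language → Language
  Star X w = ∃[ ws ] All X ws × concat ws ≡ w

  -- The middle component of a parse is the word x itself, not a
  -- factorization of x, so parses are counted as triples of words.
  Parses : Language → Word → Pred (Word × Word × Word) 0ℓ
  Parses X w (v , x , u) =
    w ≡ v ++ x ++ u ×
    (∀ {s} → IsSuffixOf s v → s ∉ X) ×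
    x ∈ Star X ×
    (∀ {p} → IsPrefixOf p u → p ∉ X)

  -- HasParseCount X w n  means  δ_X(w) = n.
  HasParseCount : Language → Word → ℕ → Set
  HasParseCount X w = HasCard (Parses X w)

  -- HasDegree F X d  means  d_F(X) = d: every δ_X(w) with w ∈ F is finite
  -- and at most d, and the value d is attained.
  record HasDegree (F X : Language) (d : ℕ) : Set where
    field
      attained : ∃[ w ] w ∈ F × HasParseCount X w d
      bounded : ∀ {w} → w ∈ F → ∃[ n ] HasParseCount X w n × n ≤ d

{-# OPTIONS --safe #-}
module Submission where

-- Let m bound the lengths of the words of X.  Appending a letter on the left (right)
-- of w raises the number of parses by one exactly when the new word has no prefix
-- (suffix) in X.  If some factor of length m has no prefix in X, recurrence makes the
-- number of parses unbounded, whereas it is bounded as soon as all factors of length m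
-- have a suffix in X; the same holds with the two sides exchanged.  If both sides fail,
-- recurrence produces a factor that can be added to X.  Hence, by maximality, all
-- factors of length m have a prefix and a suffix in X, and all longer factors have the
-- same number d of parses.
--
-- So X is the set of leaves of the tree of factors having no proper prefix in X.  An
-- internal node has k children if it is right-special and one otherwise, whence
-- Card X = 1 + (k − 1) r with r the number of right-special internal nodes.  The
-- right-special factors are the suffixes of one another, so r counts the suffixes of a
-- long right-special factor with no prefix in X, that is, its parses: r = d.

open import Data.Empty using (⊥)
open import Data.Fin.Base using (Fin)
open import Data.Fin.Properties using (_≟_)
open import Data.List.Base using (List; []; _∷_; _++_; _∷ʳ_; length; reverse; concat; applyUpTo; map; allFin; initLast; _∷ʳ′_)
open import Data.List.Membership.Propositional using () renaming (_∈_ to _∈ˡ_)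
open import Data.List.Membership.Propositional.Properties using (∈-map⁺; ∈-map⁻; ∈-allFin)
open import Data.List.Properties using (≡-dec; length-++; length-++-≤ˡ; length-++-≤ʳ; length-map; length-tabulate; length-reverse; ++-assoc; ++-cancelˡ; ++-conicalˡ; ++-conicalʳ; ++-identityʳ; ++-identityʳ-unique; ++-identityˡ-unique; ∷-injective; ∷-injectiveʳ; ∷ʳ-injectiveˡ; ∷ʳ-injectiveʳ; reverse-++; reverse-involutive)
open import Data.List.Relation.Binary.Pointwise using (≡⇒Pointwise-≡; Pointwise-≡⇒≡)
open import Data.List.Relation.Binary.Prefix.Heterogeneous as Prefix using ()
open import Data.List.Relation.Binary.Suffix.Heterogeneous as Suffix using (here; there)
open import Data.List.Relation.Unary.All as All using (All; []; _∷_)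
open import Data.List.Relation.Unary.Any using (here; there; any?)
open import Data.List.Relation.Unary.AllPairs using ([]; _∷_)
open import Data.List.Relation.Unary.Unique.Propositional using (Unique)
open import Data.List.Relation.Unary.Unique.Propositional.Properties using (map⁺; allFin⁺)
open import Data.Nat.Base using (ℕ; zero; suc; _+_; _*_; _∸_; _≤_; _<_; _⊔_; z≤n; s≤s; s≤s⁻¹)
open import Data.Nat.Properties using (+-commutativeSemigroup; +-comm; +-assoc; +-identityʳ; +-suc; *-zeroʳ; *-distribʳ-+; *-assoc; +-cancelʳ-≡; suc-injective; ≤-refl; ≤-trans; ≤-reflexive; <-irrefl; n≤1+n; m≤m+n; m≤m⊔n; m≤n⊔m; m≤n⇒m≤1+n; m≤n⇒m<n∨m≡n; m≤n⇒∃[o]m+o≡n; m+1+n≰m; _≤?_; ≰⇒>; +-monoˡ-≤; +-monoʳ-≤)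
open import Algebra.Properties.CommutativeSemigroup +-commutativeSemigroup using (interchange)
open import Data.Nat.Tactic.RingSolver using (solve-∀)
open import Data.Product.Base using (_×_; _,_; proj₁; proj₂; ∃-syntax)
open import Data.Sum.Base using (_⊎_; inj₁; inj₂)
open import Function.Base using (_∘_; id; case_of_)
open import Function.Bundles using (_↔_; module Inverse)
open import Relation.Binary.Definitions using (DecidableEquality)
open import Relation.Binary.PropositionalEquality using (_≡_; _≢_; refl; sym; trans; cong; cong₂; subst; module ≡-Reasoning)
open import Relation.Nullary.Decidable using (Dec; yes; no; ¬?; _⊎-dec_; map′)
open import Relation.Nullary.Negation using (¬_; contradiction)
open import Defs

-- Indicators

𝟙 : ∀ {P : Set} → Dec P → ℕ
𝟙 (yes _) = 1
𝟙 (no _)  = 0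

𝟙-true : ∀ {P : Set} (P? : Dec P) → P → 𝟙 P? ≡ 1
𝟙-true (yes _) _ = refl
𝟙-true (no ¬p) p = contradiction p ¬p

𝟙-false : ∀ {P : Set} (P? : Dec P) → ¬ P → 𝟙 P? ≡ 0
𝟙-false (yes p) ¬p = contradiction p ¬p
𝟙-false (no _)  _  = refl

𝟙≤1 : ∀ {P : Set} (P? : Dec P) → 𝟙 P? ≤ 1
𝟙≤1 (yes _) = ≤-refl
𝟙≤1 (no _)  = z≤n

𝟙-cong : ∀ {P Q : Set} (P? : Dec P) (Q? : Dec Q) → (P → Q) → (Q → P) → 𝟙 P? ≡ 𝟙 Q?
𝟙-cong (yes p) Q? f g = sym (𝟙-true Q? (f p))
𝟙-cong (no ¬p) Q? f g = sym (𝟙-false Q? (¬p ∘ g))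

𝟙-⊎ : ∀ {P Q R : Set} (P? : Dec P) (Q? : Dec Q) (R? : Dec R) →
  (P → Q ⊎ R) → (Q → P) → (R → P) → (Q → ¬ R) → 𝟙 P? ≡ 𝟙 Q? + 𝟙 R?
𝟙-⊎ (yes p) (yes q) R? f g h d = cong suc (sym (𝟙-false R? (d q)))
𝟙-⊎ (yes p) (no ¬q) R? f g h d with f p
... | inj₁ q = contradiction q ¬q
... | inj₂ r = sym (𝟙-true R? r)
𝟙-⊎ (no ¬p) Q? R? f g h d =
  sym (cong₂ _+_ (𝟙-false Q? (¬p ∘ g)) (𝟙-false R? (¬p ∘ h)))

-- Prefixes and suffixes

module _ {A : Set} where

  prefix⇒++ : ∀ {u w : List A} → IsPrefixOf u w → ∃[ z ] w ≡ u ++ z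
  prefix⇒++ p with Prefix.toView p
  ... | rs Prefix.++ ds = ds , cong (_++ ds) (sym (Pointwise-≡⇒≡ rs))

  ++⇒prefix : ∀ (u z : List A) → IsPrefixOf u (u ++ z)
  ++⇒prefix u z = Prefix.fromView (≡⇒Pointwise-≡ refl Prefix.++ z)

  suffix⇒++ : ∀ {u w : List A} → IsSuffixOf u w → ∃[ z ] w ≡ z ++ u
  suffix⇒++ p with Suffix.toView p
  ... | cs Suffix.++ rs = cs , cong (cs ++_) (sym (Pointwise-≡⇒≡ rs))

  ++⇒suffix : ∀ (z u : List A) → IsSuffixOf u (z ++ u)
  ++⇒suffix z u = Suffix.fromView (z Suffix.++ ≡⇒Pointwise-≡ refl)

  ++-injective : ∀ (u u′ : List A) {v v′} → length u ≡ length u′ →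
    u ++ v ≡ u′ ++ v′ → u ≡ u′ × v ≡ v′
  ++-injective []      []        _  eq = refl , eq
  ++-injective (a ∷ u) (a′ ∷ u′) le eq
    with refl , eq′ ← ∷-injective eq
    with refl , eq″ ← ++-injective u u′ (suc-injective le) eq′ = refl , eq″

  ++-prefix-split : ∀ (y u : List A) {z v} → length y ≤ length u →
    y ++ z ≡ u ++ v → ∃[ t ] u ≡ y ++ t
  ++-prefix-split []      u       _        _  = u , refl
  ++-prefix-split (a ∷ y) (b ∷ u) (s≤s le) eq
    with refl , eq′ ← ∷-injective eq
    with t , refl ← ++-prefix-split y u le eq′ = t , refl

  length≤⇒[] : ∀ (y : List A) {z} → length (y ++ z) ≤ length y → z ≡ []
  length≤⇒[] y {[]}    _  = refl
  length≤⇒[] y {a ∷ z} le =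
    contradiction (subst (_≤ length y) (length-++ y) le) (m+1+n≰m (length y))

  ++-suffix-split : ∀ (z v : List A) {y u} → length y ≤ length u →
    z ++ y ≡ v ++ u → ∃[ t ] u ≡ t ++ y
  ++-suffix-split z       []      _  eq = z , sym eq
  ++-suffix-split (b ∷ z) (a ∷ v) le eq = ++-suffix-split z v le (∷-injectiveʳ eq)
  ++-suffix-split []      (a ∷ v) {y} {u} le eq =
    contradiction
      (≤-trans (s≤s (length-++-≤ʳ u {v})) (subst (λ t → length t ≤ length u) eq le))
      (<-irrefl refl)

  ∷ʳ-prefix-split : ∀ (y z u : List A) {a} → u ∷ʳ a ≡ y ++ z →
    y ≡ u ∷ʳ a ⊎ (∃[ t ] u ≡ y ++ t)
  ∷ʳ-prefix-split y z u eq with initLast z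
  ... | []       = inj₁ (sym (trans eq (++-identityʳ y)))
  ... | t ∷ʳ′ b = inj₂ (t , ∷ʳ-injectiveˡ u (y ++ t) (trans eq (sym (++-assoc y t _))))

  HasPrefixIn HasSuffixIn : Language {A} → Language {A}
  HasPrefixIn X w = ∃[ y ] ∃[ z ] X y × w ≡ y ++ z
  HasSuffixIn X w = ∃[ z ] ∃[ y ] X y × w ≡ z ++ y

  -- Removing the first letter of the word replaces `X` by its residual `X ∘ (a ∷_)`, so the
  -- recursion runs over all decidable languages.
  hasPrefixIn? : ∀ (X : Language {A}) → (∀ w → Dec (X w)) → ∀ w → Dec (HasPrefixIn X w)
  hasPrefixIn? X X? []      = map′ (λ p → [] , [] , p , refl) from (X? [])
    where
    from : HasPrefixIn X [] → X []
    from ([] , z , p , eq) = p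
  hasPrefixIn? X X? (a ∷ w) =
    map′ to from (X? [] ⊎-dec hasPrefixIn? (X ∘ (a ∷_)) (X? ∘ (a ∷_)) w)
    where
    to : X [] ⊎ HasPrefixIn (X ∘ (a ∷_)) w → HasPrefixIn X (a ∷ w)
    to (inj₁ p)                = [] , a ∷ w , p , refl
    to (inj₂ (y , z , p , eq)) = a ∷ y , z , p , cong (a ∷_) eq
    from : HasPrefixIn X (a ∷ w) → X [] ⊎ HasPrefixIn (X ∘ (a ∷_)) w
    from ([] , z , p , eq)       = inj₁ p
    from (b ∷ y , z , p , refl) = inj₂ (y , z , p , refl)

  hasSuffixIn? : ∀ (X : Language {A}) → (∀ w → Dec (X w)) → ∀ w → Dec (HasSuffixIn X w)
  hasSuffixIn? X X? []      = map′ (λ p → [] , [] , p , refl) from (X? [])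
    where
    from : HasSuffixIn X [] → X []
    from (z , y , p , eq) = subst X (++-conicalʳ z y (sym eq)) p
  hasSuffixIn? X X? (a ∷ w) = map′ to from (X? (a ∷ w) ⊎-dec hasSuffixIn? X X? w)
    where
    to : X (a ∷ w) ⊎ HasSuffixIn X w → HasSuffixIn X (a ∷ w)
    to (inj₁ p)                = [] , a ∷ w , p , refl
    to (inj₂ (z , y , p , eq)) = a ∷ z , y , p , cong (a ∷_) eq
    from : HasSuffixIn X (a ∷ w) → X (a ∷ w) ⊎ HasSuffixIn X w
    from ([] , y , p , eq)       = inj₁ (subst X (sym eq) p)
    from (b ∷ z , y , p , refl) = inj₂ (z , y , p , refl)

-- Parses with respect to a decidable bifix code

module Bifix {A : Set} (X : Language {A}) (X? : ∀ w → Dec (X w)) (bifix : IsBifixCode X) where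

  open IsBifixCode bifix

  prefix-free-++ : ∀ y {z} → X y → X (y ++ z) → z ≡ []
  prefix-free-++ y {[]}    _ _ = refl
  prefix-free-++ y {a ∷ z} p q = contradiction
    (++⇒prefix y (a ∷ z) , λ eq → case ++-identityʳ-unique y eq of λ ())
    (prefix-free p q)

  suffix-free-++ : ∀ z {y} → X y → X (z ++ y) → z ≡ []
  suffix-free-++ []          _ _ = refl
  suffix-free-++ (a ∷ z) {y} p q = contradiction
    (++⇒suffix (a ∷ z) y , λ eq → case ++-identityˡ-unique (a ∷ z) eq of λ ())
    (suffix-free p q)

  noPrefix? : ∀ w → Dec (¬ HasPrefixIn X w)
  noPrefix? w = ¬? (hasPrefixIn? X X? w)

  noSuffix? : ∀ w → Dec (¬ HasSuffixIn X w)
  noSuffix? w = ¬? (hasSuffixIn? X X? w)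

  ¬hasPrefix[] : ¬ HasPrefixIn X []
  ¬hasPrefix[] ([] , z , p , eq) = nonempty p

  ¬hasSuffix[] : ¬ HasSuffixIn X []
  ¬hasSuffix[] (z , y , p , eq) = nonempty (subst X (++-conicalʳ z y (sym eq)) p)

  -- The only prefix that `u ∷ʳ a` has beyond those of `u` is itself; if it lies in `X`,
  -- prefix-freeness keeps every prefix of `u` out of `X`.
  noPrefix-∷ʳ : ∀ u a → 𝟙 (noPrefix? u) ≡ 𝟙 (noPrefix? (u ∷ʳ a)) + 𝟙 (X? (u ∷ʳ a))
  noPrefix-∷ʳ u a = 𝟙-⊎ (noPrefix? u) (noPrefix? (u ∷ʳ a)) (X? (u ∷ʳ a)) split
    (λ np → λ (y , z , p , eq) → np (y , z ∷ʳ a , p , trans (cong (_∷ʳ a) eq) (++-assoc y z _)))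
    (λ q → λ (y , z , p , eq) → nonsplit q y z p eq)
    (λ np q → np (u ∷ʳ a , [] , q , sym (++-identityʳ (u ∷ʳ a))))
    where
    split : ¬ HasPrefixIn X u → ¬ HasPrefixIn X (u ∷ʳ a) ⊎ X (u ∷ʳ a)
    split np with X? (u ∷ʳ a)
    ... | yes q = inj₂ q
    ... | no ¬q = inj₁ λ (y , z , p , eq) → case ∷ʳ-prefix-split y z u eq of λ
      { (inj₁ refl)      → ¬q p
      ; (inj₂ (t , eq′)) → np (y , t , p , eq′) }
    nonsplit : X (u ∷ʳ a) → ∀ y z → X y → u ≡ y ++ z → ⊥
    nonsplit q y z p refl =
      case ++-conicalʳ z (a ∷ []) (prefix-free-++ y p (subst X (++-assoc y z _) q)) of λ ()

  noSuffix-∷ : ∀ a u → 𝟙 (noSuffix? u) ≡ 𝟙 (noSuffix? (a ∷ u)) + 𝟙 (X? (a ∷ u))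
  noSuffix-∷ a u = 𝟙-⊎ (noSuffix? u) (noSuffix? (a ∷ u)) (X? (a ∷ u)) split
    (λ ns → λ (z , y , p , eq) → ns (a ∷ z , y , p , cong (a ∷_) eq))
    (λ q → λ { (z , y , p , refl) → case suffix-free-++ (a ∷ z) p q of λ () })
    (λ ns q → ns ([] , a ∷ u , q , refl))
    where
    split : ¬ HasSuffixIn X u → ¬ HasSuffixIn X (a ∷ u) ⊎ X (a ∷ u)
    split ns with X? (a ∷ u)
    ... | yes q = inj₂ q
    ... | no ¬q = inj₁ λ
      { ([] , y , p , refl)    → ¬q p
      ; (b ∷ z , y , p , refl) → ns (z , y , p , refl) }

  -- Counts the suffixes that have no prefix in `X`. Each is the last component of exactly one
  -- parse, since what precedes it can be read backwards in only one way, `X` being a suffix code.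
  -- The empty suffix always counts, whence the initial 1.
  parseCount : List A → ℕ
  parseCount []      = 1
  parseCount (a ∷ w) = parseCount w + 𝟙 (noPrefix? (a ∷ w))

  -- Both noPrefix(bw) − noPrefix(bwa) and noSuffix(wa) − noSuffix(bwa) equal
  -- the indicator of bwa ∈ X.
  parseCount-∷ʳ : ∀ w a → parseCount (w ∷ʳ a) ≡ parseCount w + 𝟙 (noSuffix? (w ∷ʳ a))
  parseCount-∷ʳ [] a = cong suc (+-cancelʳ-≡ (𝟙 (X? (a ∷ []))) _ _ (begin
    𝟙 (noPrefix? (a ∷ [])) + 𝟙 (X? (a ∷ []))  ≡⟨ noPrefix-∷ʳ [] a ⟨
    𝟙 (noPrefix? [])                         ≡⟨ 𝟙-true (noPrefix? []) ¬hasPrefix[] ⟩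
    1                                       ≡⟨ 𝟙-true (noSuffix? []) ¬hasSuffix[] ⟨
    𝟙 (noSuffix? [])                         ≡⟨ noSuffix-∷ a [] ⟩
    𝟙 (noSuffix? (a ∷ [])) + 𝟙 (X? (a ∷ [])) ∎))
    where open ≡-Reasoning
  parseCount-∷ʳ (b ∷ w) a = begin
    parseCount (w ∷ʳ a) + np          ≡⟨ cong (_+ np) (parseCount-∷ʳ w a) ⟩
    parseCount w + 𝟙 (noSuffix? (w ∷ʳ a)) + np
      ≡⟨ cong (λ t → parseCount w + t + np) (noSuffix-∷ b (w ∷ʳ a)) ⟩
    parseCount w + (ns + inX) + np    ≡⟨ rearrange (parseCount w) ns inX np ⟩
    parseCount w + (np + inX) + ns
      ≡⟨ cong (λ t → parseCount w + t + ns) (noPrefix-∷ʳ (b ∷ w) a) ⟨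
    parseCount w + 𝟙 (noPrefix? (b ∷ w)) + ns ∎
    where
    open ≡-Reasoning
    np  = 𝟙 (noPrefix? (b ∷ w ∷ʳ a))
    ns  = 𝟙 (noSuffix? (b ∷ w ∷ʳ a))
    inX = 𝟙 (X? (b ∷ w ∷ʳ a))
    rearrange : ∀ c s i p → c + (s + i) + p ≡ c + (p + i) + s
    rearrange = solve-∀

  parseCount≤ : ∀ w → parseCount w ≤ suc (length w)
  parseCount≤ []      = ≤-refl
  parseCount≤ (a ∷ w) = ≤-trans (+-monoˡ-≤ _ (parseCount≤ w))
    (≤-trans (+-monoʳ-≤ (suc (length w)) (𝟙≤1 (noPrefix? (a ∷ w))))
      (≤-reflexive (+-comm _ 1)))

  -- Enumeration of the parses of a word.

  Triple : Set
  Triple = List A × List A × List A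

  -- The only parse of aw that does not extend a parse of w is ([] , [] , aw).
  extend : A → Triple → Triple
  extend a (v , x , u) with X? (a ∷ v)
  ... | yes _ = [] , (a ∷ v) ++ x , u
  ... | no _  = a ∷ v , x , u

  addTrivial : ∀ w → Dec (¬ HasPrefixIn X w) → List Triple → List Triple
  addTrivial w (yes _) ts = ([] , [] , w) ∷ ts
  addTrivial w (no _)  ts = ts

  parses : List A → List Triple
  parses []      = ([] , [] , []) ∷ []
  parses (a ∷ w) = addTrivial (a ∷ w) (noPrefix? (a ∷ w)) (map (extend a) (parses w))

  length-parses : ∀ w → length (parses w) ≡ parseCount w
  length-parses []      = refl
  length-parses (a ∷ w) = trans (add (noPrefix? (a ∷ w)) (map (extend a) (parses w)))
    (cong (_+ 𝟙 (noPrefix? (a ∷ w)))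
      (trans (length-map (extend a) (parses w)) (length-parses w)))
    where
    add : ∀ {w} (d : Dec (¬ HasPrefixIn X w)) ts → length (addTrivial w d ts) ≡ length ts + 𝟙 d
    add (yes _) ts = +-comm 1 (length ts)
    add (no _)  ts = sym (+-identityʳ _)

  prefix-unique : ∀ y y′ {z z′} → X y → X y′ → y ++ z ≡ y′ ++ z′ → y ≡ y′
  prefix-unique y y′ p p′ eq with length y ≤? length y′
  ... | yes le with t , refl ← ++-prefix-split y y′ le eq
               with refl ← prefix-free-++ y p p′ = sym (++-identityʳ y)
  ... | no ¬le with t , refl ← ++-prefix-split y′ y (≤-trans (n≤1+n _) (≰⇒> ¬le)) (sym eq)
               with refl ← prefix-free-++ y′ p′ p = ++-identityʳ y′

  -- Whether the first component is empty tells which case of `extend` was taken. In the absorbing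
  -- case `prefix-unique` recovers the factor `a ∷ v` from the middle word.
  extend-injective : ∀ a {t t′} → extend a t ≡ extend a t′ → t ≡ t′
  extend-injective a {v , x , u} {v′ , x′ , u′} eq with X? (a ∷ v) | X? (a ∷ v′)
  ... | no _  | no _ with refl ← eq = refl
  ... | yes p | yes p′
    with refl ← prefix-unique (a ∷ v) (a ∷ v′) p p′ (cong (proj₁ ∘ proj₂) eq)
    with refl ← ++-cancelˡ (a ∷ v) x x′ (cong (proj₁ ∘ proj₂) eq)
    with refl ← cong (proj₂ ∘ proj₂) eq = refl

  extend-nontrivial : ∀ a t {w} → ([] , [] , w) ≢ extend a t
  extend-nontrivial a (v , x , u) eq with X? (a ∷ v)
  ... | yes _ = case cong (proj₁ ∘ proj₂) eq of λ ()
  ... | no _  = case cong proj₁ eq of λ ()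

  parses-unique : ∀ w → Unique (parses w)
  parses-unique []      = [] ∷ []
  parses-unique (a ∷ w) = add (noPrefix? (a ∷ w))
    where
    ts = map (extend a) (parses w)
    ts! : Unique ts
    ts! = map⁺ (extend-injective a) (parses-unique w)
    add : (d : Dec (¬ HasPrefixIn X (a ∷ w))) → Unique (addTrivial (a ∷ w) d ts)
    add (no _)  = ts!
    add (yes _) = All.tabulate fresh ∷ ts!
      where
      fresh : ∀ {t} → t ∈ˡ ts → ([] , [] , a ∷ w) ≢ t
      fresh t∈ eq with s , _ , refl ← ∈-map⁻ (extend a) t∈ = extend-nontrivial a s eq

  suffix[]∉ : ∀ {s} → IsSuffixOf s [] → ¬ X s
  suffix[]∉ suf p with z , eq ← suffix⇒++ suf = ¬hasSuffix[] (z , _ , p , eq)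

  -- If `a ∷ v` is in `X`, it becomes the first factor of the middle word. Otherwise it is the only
  -- new suffix of the left part, which still has no suffix in `X`.
  extend-sound : ∀ a {w} t → Parses X w t → Parses X (a ∷ w) (extend a t)
  extend-sound a (v , x , u) (eq , nv , (ws , ps , refl) , nu) with X? (a ∷ v)
  ... | yes p = cong (a ∷_) (trans eq (sym (++-assoc v x u))) , suffix[]∉
              , ((a ∷ v) ∷ ws , p ∷ ps , refl) , nu
  ... | no ¬p = cong (a ∷_) eq , ns , (ws , ps , refl) , nu
    where
    ns : ∀ {s} → IsSuffixOf s (a ∷ v) → ¬ X s
    ns (here rs) q with refl ← Pointwise-≡⇒≡ rs = ¬p q
    ns (there s) q = nv s q

  trivial-sound : ∀ {w} → ¬ HasPrefixIn X w → Parses X w ([] , [] , w)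
  trivial-sound np = refl , suffix[]∉ , ([] , [] , refl) , λ pre q →
    case prefix⇒++ pre of λ (z , eq) → np (_ , z , q , eq)

  parses-sound : ∀ w {t} → t ∈ˡ parses w → Parses X w t
  parses-sound []      (here refl) = trivial-sound ¬hasPrefix[]
  parses-sound (a ∷ w) = add (noPrefix? (a ∷ w))
    where
    old : ∀ {t} → t ∈ˡ map (extend a) (parses w) → Parses X (a ∷ w) t
    old t∈ with s , s∈ , refl ← ∈-map⁻ (extend a) t∈ = extend-sound a s (parses-sound w s∈)
    add : ∀ d {t} → t ∈ˡ addTrivial (a ∷ w) d (map (extend a) (parses w)) → Parses X (a ∷ w) t
    add (yes np) (here refl) = trivial-sound np
    add (yes np) (there t∈)  = old t∈
    add (no _)   t∈          = old t∈

  -- Inverts `extend`: a nonempty left part loses its first letter; an empty one is followed by a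
  -- first factor `a ∷ y` of the middle word, and `y` is the left part to restore. If both are
  -- empty, only the trivial parse remains.
  parses-complete : ∀ w {t} → Parses X w t → t ∈ˡ parses w
  parses-complete [] {v , x , u} (eq , _)
    with refl ← ++-conicalˡ v (x ++ u) (sym eq)
    with refl ← ++-conicalˡ x u (sym eq)
    with refl ← eq = here refl
  parses-complete (a ∷ w) {t} = add (noPrefix? (a ∷ w)) t
    where
    ts = map (extend a) (parses w)
    Pending : Dec (¬ HasPrefixIn X (a ∷ w)) → Set
    Pending d = ∀ t → Parses X (a ∷ w) t → t ∈ˡ addTrivial (a ∷ w) d ts
    keep : ∀ d {t} → t ∈ˡ ts → t ∈ˡ addTrivial (a ∷ w) d ts
    keep (yes _) t∈ = there t∈
    keep (no _)  t∈ = t∈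
    extend-yes : ∀ v x u → X (a ∷ v) → extend a (v , x , u) ≡ ([] , (a ∷ v) ++ x , u)
    extend-yes v x u p with X? (a ∷ v)
    ... | yes _ = refl
    ... | no ¬p = contradiction p ¬p
    extend-no : ∀ v x u → ¬ X (a ∷ v) → extend a (v , x , u) ≡ (a ∷ v , x , u)
    extend-no v x u ¬p with X? (a ∷ v)
    ... | yes p = contradiction p ¬p
    ... | no _  = refl
    add : ∀ d → Pending d
    add d (b ∷ v , x , u) (eq , nv , sx , nu)
      with refl , eq′ ← ∷-injective eq =
      keep d (subst (_∈ˡ ts) (extend-no v x u (nv (++⇒suffix [] (a ∷ v))))
        (∈-map⁺ (extend a) (parses-complete w (eq′ , (λ s → nv (there s)) , sx , nu))))
    add d ([] , x , u) (eq , nv , ([] ∷ ws , p ∷ ps , refl) , nu) = contradiction p nonempty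
    add d ([] , x , u) (eq , nv , ((b ∷ y) ∷ ws , p ∷ ps , refl) , nu)
      with refl , eq′ ← ∷-injective eq =
      keep d (subst (_∈ˡ ts) (extend-yes y (concat ws) u p)
        (∈-map⁺ (extend a) (parses-complete w
          (trans eq′ (++-assoc y (concat ws) u) , ny , (ws , ps , refl) , nu))))
      where
      -- A suffix of `y` in `X` would be a proper suffix of the code word `a ∷ y`.
      ny : ∀ {s} → IsSuffixOf s y → ¬ X s
      ny suf q with z , refl ← suffix⇒++ suf = case suffix-free-++ (a ∷ z) q p of λ ()
    add (yes _) ([] , x , u) (refl , nv , ([] , ps , refl) , nu) = here refl
    add (no ¬np) ([] , x , u) (refl , nv , ([] , ps , refl) , nu) =
      contradiction (λ (y , z , p , eq) → nu (subst (IsPrefixOf y) (sym eq) (++⇒prefix y z)) p) ¬np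

  hasParseCount : ∀ w → HasParseCount X w (parseCount w)
  hasParseCount w =
    parses w , parses-unique w , (parses-sound w , parses-complete w) , length-parses w

-- Sums over words of a given length

∑ : ∀ {B : Set} → List B → (B → ℕ) → ℕ
∑ []       f = 0
∑ (b ∷ bs) f = f b + ∑ bs f

module _ {B : Set} where

  ∑-cong : ∀ (bs : List B) {f g} → (∀ b → f b ≡ g b) → ∑ bs f ≡ ∑ bs g
  ∑-cong []       eq = refl
  ∑-cong (b ∷ bs) eq = cong₂ _+_ (eq b) (∑-cong bs eq)

  ∑-+ : ∀ (bs : List B) f g → ∑ bs (λ b → f b + g b) ≡ ∑ bs f + ∑ bs g
  ∑-+ []       f g = refl
  ∑-+ (b ∷ bs) f g = trans (cong (f b + g b +_) (∑-+ bs f g)) (interchange (f b) (g b) _ _)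

  ∑-*ʳ : ∀ (bs : List B) f c → ∑ bs (λ b → f b * c) ≡ ∑ bs f * c
  ∑-*ʳ []       f c = refl
  ∑-*ʳ (b ∷ bs) f c = trans (cong (f b * c +_) (∑-*ʳ bs f c)) (sym (*-distribʳ-+ c (f b) _))

  ∑-one : ∀ (bs : List B) {f} → (∀ b → f b ≡ 1) → ∑ bs f ≡ length bs
  ∑-one []       eq = refl
  ∑-one (b ∷ bs) eq = cong₂ _+_ (eq b) (∑-one bs eq)

  ∑-zero : ∀ (bs : List B) {f} → All (λ b → f b ≡ 0) bs → ∑ bs f ≡ 0
  ∑-zero []       []        = refl
  ∑-zero (b ∷ bs) (eq ∷ es) = cong₂ _+_ eq (∑-zero bs es)

  ∑-𝟙 : ∀ (_≟_ : DecidableEquality B) {bs b} → Unique bs → b ∈ˡ bs →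
    ∑ bs (λ c → 𝟙 (c ≟ b)) ≡ 1
  ∑-𝟙 _≟_ {c ∷ bs} (c∉ ∷ _) (here refl) =
    cong₂ _+_ (𝟙-true (c ≟ c) refl)
      (∑-zero bs (All.map (λ c≢ → 𝟙-false (_ ≟ c) (c≢ ∘ sym)) c∉))
  ∑-𝟙 _≟_ {c ∷ bs} {b} (c∉ ∷ bs!) (there b∈) =
    cong₂ _+_ (𝟙-false (c ≟ b) (All.lookup c∉ b∈)) (∑-𝟙 _≟_ bs! b∈)

length-∷ʳ : ∀ {A : Set} (u : List A) a → length (u ∷ʳ a) ≡ suc (length u)
length-∷ʳ u a = trans (length-++ u) (+-comm (length u) 1)

module WordSums {A : Set} (_≟_ : DecidableEquality A) (letters : List A)
  (letters! : Unique letters) (letters-complete : ∀ a → a ∈ˡ letters) where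

  _≟ʷ_ : DecidableEquality (List A)
  _≟ʷ_ = ≡-dec _≟_

  -- Having the last letter vary innermost groups the words of length `suc ℓ` by their parent in the
  -- prefix tree.
  ∑ʷ : ℕ → (List A → ℕ) → ℕ
  ∑ʷ zero    f = f []
  ∑ʷ (suc ℓ) f = ∑ʷ ℓ (λ u → ∑ letters (λ a → f (u ∷ʳ a)))

  ∑ʷ-cong : ∀ ℓ {f g} → (∀ u → length u ≡ ℓ → f u ≡ g u) → ∑ʷ ℓ f ≡ ∑ʷ ℓ g
  ∑ʷ-cong zero    eq = eq [] refl
  ∑ʷ-cong (suc ℓ) eq = ∑ʷ-cong ℓ (λ u le →
    ∑-cong letters (λ a → eq (u ∷ʳ a) (trans (length-∷ʳ u a) (cong suc le))))

  ∑ʷ-+ : ∀ ℓ f g → ∑ʷ ℓ (λ u → f u + g u) ≡ ∑ʷ ℓ f + ∑ʷ ℓ g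
  ∑ʷ-+ zero    f g = refl
  ∑ʷ-+ (suc ℓ) f g = trans
    (∑ʷ-cong ℓ (λ u _ → ∑-+ letters (λ a → f (u ∷ʳ a)) (λ a → g (u ∷ʳ a))))
    (∑ʷ-+ ℓ _ _)

  ∑ʷ-*ʳ : ∀ ℓ f c → ∑ʷ ℓ (λ u → f u * c) ≡ ∑ʷ ℓ f * c
  ∑ʷ-*ʳ zero    f c = refl
  ∑ʷ-*ʳ (suc ℓ) f c = trans
    (∑ʷ-cong ℓ (λ u _ → ∑-*ʳ letters (λ a → f (u ∷ʳ a)) c))
    (∑ʷ-*ʳ ℓ _ c)

  ∑ʷ-zero : ∀ ℓ {f} → (∀ u → length u ≡ ℓ → f u ≡ 0) → ∑ʷ ℓ f ≡ 0
  ∑ʷ-zero ℓ {f} eq = trans (∑ʷ-cong ℓ {g = λ u → f u * 0} (λ u le → trans (eq u le) (sym (*-zeroʳ (f u)))))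
    (trans (∑ʷ-*ʳ ℓ f 0) (*-zeroʳ (∑ʷ ℓ f)))

  ∑ʷ-𝟙 : ∀ ℓ y → length y ≡ ℓ → ∑ʷ ℓ (λ w → 𝟙 (w ≟ʷ y)) ≡ 1
  ∑ʷ-𝟙 zero    []      _  = refl
  ∑ʷ-𝟙 (suc ℓ) y       le with initLast y
  ... | z ∷ʳ′ b = trans (∑ʷ-cong ℓ (λ u _ → last u))
    (∑ʷ-𝟙 ℓ z (suc-injective (trans (sym (length-∷ʳ z b)) le)))
    where
    last : ∀ u → ∑ letters (λ a → 𝟙 ((u ∷ʳ a) ≟ʷ (z ∷ʳ b))) ≡ 𝟙 (u ≟ʷ z)
    last u with u ≟ʷ z
    ... | yes refl = trans
      (∑-cong letters (λ a → 𝟙-cong ((u ∷ʳ a) ≟ʷ (u ∷ʳ b)) (a ≟ b) (∷ʳ-injectiveʳ u u) (cong (u ∷ʳ_))))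
      (∑-𝟙 _≟_ letters! (letters-complete b))
    ... | no u≢z = ∑-zero letters
      (All.tabulate λ _ → 𝟙-false (_ ≟ʷ _) (u≢z ∘ ∷ʳ-injectiveˡ u z))

  ∑≤ : ℕ → (List A → ℕ) → ℕ
  ∑≤ zero    f = ∑ʷ zero f
  ∑≤ (suc ℓ) f = ∑≤ ℓ f + ∑ʷ (suc ℓ) f

  ∑≤-cong : ∀ ℓ {f g} → (∀ u → f u ≡ g u) → ∑≤ ℓ f ≡ ∑≤ ℓ g
  ∑≤-cong zero    eq = eq []
  ∑≤-cong (suc ℓ) eq = cong₂ _+_ (∑≤-cong ℓ eq) (∑ʷ-cong (suc ℓ) (λ u _ → eq u))

  ∑≤-+ : ∀ ℓ f g → ∑≤ ℓ (λ u → f u + g u) ≡ ∑≤ ℓ f + ∑≤ ℓ g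
  ∑≤-+ zero    f g = refl
  ∑≤-+ (suc ℓ) f g = trans (cong₂ _+_ (∑≤-+ ℓ f g) (∑ʷ-+ (suc ℓ) f g))
    (interchange (∑≤ ℓ f) (∑≤ ℓ g) _ _)

  ∑≤-𝟙-long : ∀ ℓ y → ℓ < length y → ∑≤ ℓ (λ w → 𝟙 (w ≟ʷ y)) ≡ 0
  ∑≤-𝟙-long zero    (b ∷ y) _  = refl
  ∑≤-𝟙-long (suc ℓ) y       lt = cong₂ _+_ (∑≤-𝟙-long ℓ y (≤-trans (n≤1+n _) lt))
    (∑ʷ-zero (suc ℓ) λ u le → 𝟙-false (u ≟ʷ y) λ { refl → <-irrefl (sym le) lt })

  ∑≤-𝟙 : ∀ ℓ y → length y ≤ ℓ → ∑≤ ℓ (λ w → 𝟙 (w ≟ʷ y)) ≡ 1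
  ∑≤-𝟙 zero    []      _  = refl
  ∑≤-𝟙 (suc ℓ) y       le with m≤n⇒m<n∨m≡n le
  ... | inj₁ lt = cong₂ _+_ (∑≤-𝟙 ℓ y (s≤s⁻¹ lt))
    (∑ʷ-zero (suc ℓ) λ u le′ → 𝟙-false (u ≟ʷ y) λ { refl → <-irrefl le′ lt })
  ... | inj₂ eq = cong₂ _+_ (∑≤-𝟙-long ℓ y (≤-reflexive (sym eq))) (∑ʷ-𝟙 (suc ℓ) y eq)

  ∑≤-∈ : ∀ ℓ {ys} → Unique ys → All (λ y → length y ≤ ℓ) ys →
    (∈? : ∀ w → Dec (w ∈ˡ ys)) → ∑≤ ℓ (𝟙 ∘ ∈?) ≡ length ys
  ∑≤-∈ ℓ {[]} [] [] ∈? = trans (∑≤-cong ℓ (λ w → 𝟙-false (∈? w) λ ())) (zeros ℓ)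
    where
    zeros : ∀ ℓ → ∑≤ ℓ (λ _ → 0) ≡ 0
    zeros zero    = refl
    zeros (suc ℓ) = cong₂ _+_ (zeros ℓ) (∑ʷ-zero (suc ℓ) (λ _ _ → refl))
  ∑≤-∈ ℓ {y ∷ ys} (y∉ ∷ ys!) (le ∷ les) ∈? = begin
    ∑≤ ℓ (𝟙 ∘ ∈?)                                    ≡⟨ ∑≤-cong ℓ split ⟩
    ∑≤ ℓ (λ w → 𝟙 (w ≟ʷ y) + 𝟙 (tail? w))            ≡⟨ ∑≤-+ ℓ _ _ ⟩
    ∑≤ ℓ (λ w → 𝟙 (w ≟ʷ y)) + ∑≤ ℓ (𝟙 ∘ tail?)
      ≡⟨ cong₂ _+_ (∑≤-𝟙 ℓ y le) (∑≤-∈ ℓ ys! les tail?) ⟩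
    suc (length ys)                                  ∎
    where
    open ≡-Reasoning
    tail? : ∀ w → Dec (w ∈ˡ ys)
    tail? w = any? (w ≟ʷ_) ys
    split : ∀ w → 𝟙 (∈? w) ≡ 𝟙 (w ≟ʷ y) + 𝟙 (tail? w)
    split w = 𝟙-⊎ (∈? w) (w ≟ʷ y) (tail? w)
      (λ { (here eq) → inj₁ eq ; (there w∈) → inj₂ w∈ }) here there
      (λ { refl w∈ → All.lookup y∉ w∈ refl })

-- Factors of an infinite word

module Windows {A : Set} (x : InfiniteWord {A}) where

  window : ℕ → ℕ → List A
  window i zero    = []
  window i (suc n) = x i ∷ window (suc i) n

  length-window : ∀ i n → length (window i n) ≡ n
  length-window i zero    = refl
  length-window i (suc n) = cong suc (length-window (suc i) n)

  window-applyUpTo : ∀ i n {f : ℕ → A} → (∀ j → f j ≡ x (i + j)) → window i n ≡ applyUpTo f n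
  window-applyUpTo i zero    eq = refl
  window-applyUpTo i (suc n) eq = cong₂ _∷_
    (sym (trans (eq 0) (cong x (+-identityʳ i))))
    (window-applyUpTo (suc i) n (λ j → trans (eq (suc j)) (cong x (+-suc i j))))

  window∈ : ∀ i n → Factors x (window i n)
  window∈ i n = i , n , window-applyUpTo i n (λ _ → refl)

  occurrence : ∀ {w} → Factors x w → ∃[ i ] w ≡ window i (length w)
  occurrence (i , n , refl) = i ,
    trans (sym eq) (cong (window i) (trans (sym (length-window i n)) (cong length eq)))
    where
    eq : window i n ≡ applyUpTo (λ j → x (i + j)) n
    eq = window-applyUpTo i n (λ _ → refl)

  window-++ : ∀ i m n → window i (m + n) ≡ window i m ++ window (i + m) n
  window-++ i zero    n = cong (λ j → window j n) (sym (+-identityʳ i))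
  window-++ i (suc m) n = cong (x i ∷_)
    (trans (window-++ (suc i) m n)
      (cong (λ j → window (suc i) m ++ window j n) (sym (+-suc i m))))

  window-∷ʳ : ∀ i n → window i (suc n) ≡ window i n ∷ʳ x (i + n)
  window-∷ʳ i n = trans (cong (window i) (+-comm 1 n)) (window-++ i n 1)

  occurrence-++ : ∀ u v → Factors x (u ++ v) →
    ∃[ i ] u ≡ window i (length u) × v ≡ window (i + length u) (length v)
  occurrence-++ u v p with i , eq ← occurrence p =
    i , ++-injective u _ (sym (length-window i _))
      (trans eq (trans (cong (window i) (length-++ u)) (window-++ i (length u) (length v))))

  factor-++ˡ : ∀ u v → Factors x (u ++ v) → Factors x u
  factor-++ˡ u v p with i , eq , _ ← occurrence-++ u v p =
    subst (Factors x) (sym eq) (window∈ i (length u))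

  factor-++ʳ : ∀ u v → Factors x (u ++ v) → Factors x v
  factor-++ʳ u v p with i , _ , eq ← occurrence-++ u v p =
    subst (Factors x) (sym eq) (window∈ (i + length u) (length v))

  -- The reversal of w occurs at some position s; in the reversed prefix of length
  -- s + ∣w∣ + M, which is again a factor, w is preceded by M letters.
  recurrent : (∀ {w} → Factors x w → Factors x (reverse w)) →
    ∀ {w} → Factors x w → ∀ M → ∃[ j ] w ≡ window (M + j) (length w)
  recurrent rev {w} w∈ M with s , eq ← occurrence (rev w∈) = i , trans w≡ (cong (λ t → window t (length w)) shift)
    where
    n = length (reverse w)
    late : List A
    late = reverse (window (s + n) M)
    unfold : reverse (window 0 (s + (n + M))) ≡ late ++ (w ++ reverse (window 0 s))
    unfold = begin
      reverse (window 0 (s + (n + M)))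
        ≡⟨ cong reverse (window-++ 0 s (n + M)) ⟩
      reverse (window 0 s ++ window s (n + M))
        ≡⟨ reverse-++ (window 0 s) _ ⟩
      reverse (window s (n + M)) ++ reverse (window 0 s)
        ≡⟨ cong (λ t → reverse t ++ reverse (window 0 s)) (window-++ s n M) ⟩
      reverse (window s n ++ window (s + n) M) ++ reverse (window 0 s)
        ≡⟨ cong (_++ reverse (window 0 s)) (reverse-++ (window s n) _) ⟩
      (late ++ reverse (window s n)) ++ reverse (window 0 s)
        ≡⟨ cong (λ t → (late ++ reverse t) ++ reverse (window 0 s)) eq ⟨
      (late ++ reverse (reverse w)) ++ reverse (window 0 s)
        ≡⟨ cong (λ t → (late ++ t) ++ reverse (window 0 s)) (reverse-involutive w) ⟩
      (late ++ w) ++ reverse (window 0 s)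
        ≡⟨ ++-assoc late w _ ⟩
      late ++ (w ++ reverse (window 0 s)) ∎
      where open ≡-Reasoning
    occ : ∃[ i ] late ≡ window i (length late) × w ++ reverse (window 0 s) ≡ window (i + length late) (length (w ++ reverse (window 0 s)))
    occ = occurrence-++ late _ (subst (Factors x) unfold (rev (window∈ 0 (s + (n + M)))))
    i = proj₁ occ
    w≡ : w ≡ window (i + length late) (length w)
    w≡ = proj₁ (++-injective w _ (sym (length-window _ _)) (trans (proj₂ (proj₂ occ))
      (trans (cong (window (i + length late)) (length-++ w)) (window-++ _ (length w) _))))
    shift : i + length late ≡ M + i
    shift = trans (cong (i +_) (trans (length-reverse (window (s + n) M)) (length-window (s + n) M))) (+-comm i M)

-- Right-special factors and decidability of the set of factors.

module StrictEpisturmian {A : Set} (_≟_ : DecidableEquality A) (letters : List A)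
  (letters! : Unique letters) (letters-complete : ∀ a → a ∈ˡ letters)
  (x : InfiniteWord {A}) (strict : IsStrictEpisturmian x) where

  open Windows x
  open WordSums _≟_ letters letters! letters-complete
  open IsStrictEpisturmian strict

  special : ℕ → List A
  special ℓ = proj₁ (exactlyOne-rightSpecial ℓ)

  length-special : ∀ ℓ → length (special ℓ) ≡ ℓ
  length-special ℓ = proj₁ (proj₁ (proj₂ (exactlyOne-rightSpecial ℓ)))

  special-rightSpecial : ∀ ℓ → RightSpecial (Factors x) (special ℓ)
  special-rightSpecial ℓ = proj₂ (proj₁ (proj₂ (exactlyOne-rightSpecial ℓ)))

  rightSpecial⇒special : ∀ ℓ {u} → length u ≡ ℓ → RightSpecial (Factors x) u → u ≡ special ℓ
  rightSpecial⇒special ℓ le r = sym (proj₂ (proj₂ (exactlyOne-rightSpecial ℓ)) (le , r))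

  special∈ : ∀ ℓ → Factors x (special ℓ)
  special∈ ℓ = proj₁ (special-rightSpecial ℓ)

  -- Deleting the first letter of a right-special word keeps two distinct extensions among the
  -- factors, and there is only one right-special word of each length.
  special-suffix : ∀ ℓ → ∃[ a ] special (suc ℓ) ≡ a ∷ special ℓ
  special-suffix ℓ with special (suc ℓ) | length-special (suc ℓ) | special-rightSpecial (suc ℓ)
  ... | a ∷ u | le | u∈ , b , c , b≢c , ub , uc = a , cong (a ∷_)
    (rightSpecial⇒special ℓ (suc-injective le)
      (factor-++ʳ (a ∷ []) u u∈ , b , c , b≢c ,
       factor-++ʳ (a ∷ []) (u ∷ʳ b) ub , factor-++ʳ (a ∷ []) (u ∷ʳ c) uc))

  -- The letter after one chosen occurrence; by `next-unique` the choice can matter only for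
  -- right-special `u`.
  next : ∀ {u} → Factors x u → A
  next {u} u∈ = x (proj₁ (occurrence u∈) + length u)

  next∈ : ∀ {u} (u∈ : Factors x u) → Factors x (u ∷ʳ next u∈)
  next∈ {u} u∈ = subst (λ t → Factors x (t ∷ʳ next u∈)) (sym (proj₂ (occurrence u∈)))
    (subst (Factors x) (window-∷ʳ _ (length u)) (window∈ _ (suc (length u))))

  next-unique : ∀ {u} (u∈ : Factors x u) {ℓ} → length u ≡ ℓ → u ≢ special ℓ →
    ∀ {a} → Factors x (u ∷ʳ a) → a ≡ next u∈
  next-unique {u} u∈ le u≢ {a} ua with a ≟ next u∈
  ... | yes eq = eq
  ... | no a≢  = contradiction
    (rightSpecial⇒special _ le (u∈ , a , next u∈ , a≢ , ua , next∈ u∈)) u≢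

  special-full : ∀ ℓ a → Factors x (special ℓ ∷ʳ a)
  special-full ℓ = rightSpecial-full (special-rightSpecial ℓ)

  private
    -- A search through the infinite word need not end. Instead, `u ∷ʳ a` is a factor exactly when
    -- `u` is one and either `u` is the right-special word of its length or `a` is the only possible
    -- successor.
    factorOfLength? : ∀ ℓ w → length w ≡ ℓ → Dec (Factors x w)
    factorOfLength? zero    [] _  = yes (window∈ 0 0)
    factorOfLength? (suc ℓ) w  le with initLast w
    ... | u ∷ʳ′ a with le′ ← suc-injective (trans (sym (length-∷ʳ u a)) le)
      with factorOfLength? ℓ u le′ | u ≟ʷ special ℓ
    ... | no u∉  | _        = no (u∉ ∘ factor-++ˡ u (a ∷ []))
    ... | yes u∈ | yes refl = yes (special-full ℓ a)
    ... | yes u∈ | no u≢    with a ≟ next u∈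
    ... | yes refl = yes (next∈ u∈)
    ... | no a≢    = no (a≢ ∘ next-unique u∈ le′ u≢)

  factor? : ∀ w → Dec (Factors x w)
  factor? w = factorOfLength? _ w refl

  -- Here `k` is the number of letters minus one: the right-special word has `1 + k` successors, any
  -- other factor exactly one.
  ∑-extensions : ∀ {k} → length letters ≡ suc k → ∀ {ℓ} u → length u ≡ ℓ →
    ∑ letters (λ a → 𝟙 (factor? (u ∷ʳ a))) ≡ 𝟙 (factor? u) + 𝟙 (u ≟ʷ special ℓ) * k
  ∑-extensions {k} #letters {ℓ} u le with factor? u | u ≟ʷ special ℓ
  ... | no u∉ | yes refl = contradiction (special∈ ℓ) u∉
  ... | no u∉ | no _ = ∑-zero letters
    (All.tabulate λ _ → 𝟙-false (factor? _) (u∉ ∘ factor-++ˡ u _))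
  ... | yes u∈ | yes refl = trans
    (∑-one letters (λ a → 𝟙-true (factor? (u ∷ʳ a)) (special-full ℓ a)))
    (trans #letters (cong suc (sym (+-identityʳ k))))
  ... | yes u∈ | no u≢ = trans
    (∑-cong letters (λ a → 𝟙-cong (factor? (u ∷ʳ a)) (a ≟ next u∈)
      (next-unique u∈ le u≢) (λ { refl → next∈ u∈ })))
    (∑-𝟙 _≟_ letters! (letters-complete (next u∈)))

-- Maximal bifix codes

module Maximal {A : Set} (x : InfiniteWord {A})
  (rev : ∀ {w} → Factors x w → Factors x (reverse w))
  (X : Language {A}) (X? : ∀ w → Dec (X w)) (max : IsMaximalBifixCode (Factors x) X)
  (m : ℕ) (1≤m : 1 ≤ m) (short : ∀ {y} → X y → length y ≤ m) where

  open IsMaximalBifixCode max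
  open IsBifixCode isBifixCode
  open Bifix X X? isBifixCode
  open Windows x

  PrefixComplete SuffixComplete : Set
  PrefixComplete = ∀ {w} → Factors x w → length w ≡ m → HasPrefixIn X w
  SuffixComplete = ∀ {w} → Factors x w → length w ≡ m → HasSuffixIn X w

  -- A prefix of `u ++ z` that lies in `X` has length at most `m`, so it is already a prefix of `u`.
  noPrefix-++ : ∀ u z → length u ≡ m → ¬ HasPrefixIn X u → ¬ HasPrefixIn X (u ++ z)
  noPrefix-++ u z le np (y , t , p , eq)
    with s , eq′ ← ++-prefix-split y u (subst (length y ≤_) (sym le) (short p)) (sym eq) =
    np (y , s , p , eq′)

  noSuffix-++ : ∀ z u → length u ≡ m → ¬ HasSuffixIn X u → ¬ HasSuffixIn X (z ++ u)
  noSuffix-++ z u le ns (t , y , p , eq)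
    with s , eq′ ← ++-suffix-split t z (subst (length y ≤_) (sym le) (short p)) (sym eq) =
    ns (s , y , p , eq′)

  -- If u is prefix-incomparable and v suffix-incomparable with X, recurrence gives
  -- a factor u z v, and X ∪ {u z v} is a larger bifix code.
  noPrefix-noSuffix-⊥ : ∀ {u v} → Factors x u → length u ≡ m → ¬ HasPrefixIn X u →
    Factors x v → length v ≡ m → ¬ HasSuffixIn X v → ⊥
  noPrefix-noSuffix-⊥ {u} {v} u∈ lu np v∈ lv ns
    with i , u≡ ← occurrence u∈
    with j , v≡ ← recurrent rev v∈ (i + length u) =
    -- If `Y` were contained in `X`, then `t` would be in `X` and hence be its own prefix in `X`.
    maximal Y Y-bifix Y⊆ (inj₁ , λ Y⊆X → t-noPrefix (t , [] , Y⊆X (inj₂ refl) , sym (++-identityʳ t)))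
    where
    gap : List A
    gap = window (i + length u) j
    t : List A
    t = u ++ (gap ++ v)
    Y : Language
    Y w = X w ⊎ w ≡ t
    t∈ : Factors x t
    t∈ = subst (Factors x) eq (window∈ i (length u + (j + length v)))
      where
      eq : window i (length u + (j + length v)) ≡ t
      eq = trans (window-++ i (length u) _) (cong₂ _++_ (sym u≡)
        (trans (window-++ (i + length u) j _) (cong (gap ++_) (sym v≡))))
    t-noPrefix : ¬ HasPrefixIn X t
    t-noPrefix = noPrefix-++ u (gap ++ v) lu np
    t-noSuffix : ¬ HasSuffixIn X t
    t-noSuffix = subst (¬_ ∘ HasSuffixIn X) (++-assoc u gap v) (noSuffix-++ (u ++ gap) v lv ns)
    m≤t : m ≤ length t
    m≤t = subst (_≤ length t) lu (length-++-≤ˡ u)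
    Y⊆ : ∀ {w} → Y w → Factors x w
    Y⊆ (inj₁ p)    = contained p
    Y⊆ (inj₂ refl) = t∈
    Y-bifix : IsBifixCode Y
    Y-bifix .IsBifixCode.nonempty (inj₁ p) = nonempty p
    -- Positivity of `m` enters here: `t` has at least `m` letters.
    Y-bifix .IsBifixCode.nonempty (inj₂ eq) =
      contradiction (≤-trans 1≤m (subst (λ w → m ≤ length w) (sym eq) m≤t)) λ ()
    Y-bifix .IsBifixCode.prefix-free (inj₁ p) (inj₁ q) = prefix-free p q
    Y-bifix .IsBifixCode.prefix-free (inj₁ p) (inj₂ refl) (pre , _)
      with z , eq ← prefix⇒++ pre = t-noPrefix (_ , z , p , eq)
    -- Words of `X` have at most `m` letters and `t` at least `m`, so no word of `X` properly
    -- extends `t`.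
    Y-bifix .IsBifixCode.prefix-free (inj₂ refl) (inj₁ q) (pre , t≢)
      with z , refl ← prefix⇒++ pre
      with refl ← length≤⇒[] t {z} (≤-trans (short q) m≤t) = t≢ (sym (++-identityʳ t))
    Y-bifix .IsBifixCode.prefix-free (inj₂ refl) (inj₂ refl) (_ , t≢) = t≢ refl
    Y-bifix .IsBifixCode.suffix-free (inj₁ p) (inj₁ q) = suffix-free p q
    Y-bifix .IsBifixCode.suffix-free (inj₁ p) (inj₂ refl) (suf , _)
      with z , eq ← suffix⇒++ suf = t-noSuffix (z , _ , p , eq)
    Y-bifix .IsBifixCode.suffix-free (inj₂ refl) (inj₁ q) (suf , t≢)
      with suffix⇒++ suf
    ... | []    , refl = t≢ refl
    ... | a ∷ z , refl = <-irrefl refl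
      (≤-trans (s≤s (length-++-≤ʳ t {z})) (≤-trans (short q) m≤t))
    Y-bifix .IsBifixCode.suffix-free (inj₂ refl) (inj₂ refl) (_ , t≢) = t≢ refl

  window-hasPrefix : PrefixComplete → ∀ i {n} → m ≤ n → HasPrefixIn X (window i n)
  window-hasPrefix pc i m≤n
    with o , refl ← m≤n⇒∃[o]m+o≡n m≤n
    with y , z , p , eq ← pc (window∈ i m) (length-window i m) =
    y , z ++ window (i + m) o , p ,
    trans (window-++ i m o) (trans (cong (_++ window (i + m) o) eq) (++-assoc y z _))

  window-hasSuffix : SuffixComplete → ∀ i {n} → m ≤ n → HasSuffixIn X (window i n)
  window-hasSuffix sc i m≤n
    with o , refl ← m≤n⇒∃[o]m+o≡n m≤n
    with z , y , p , eq ← sc (window∈ (i + o) m) (length-window (i + o) m) =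
    window i o ++ z , y , p ,
    trans (cong (window i) (+-comm m o))
      (trans (window-++ i o m) (trans (cong (window i o ++_) eq) (sym (++-assoc (window i o) z y))))

  -- Parse counts of windows, and completeness on both sides.

  δ : ℕ → ℕ → ℕ
  δ i n = parseCount (window i n)

  δ-∷ʳ : ∀ i n → δ i (suc n) ≡ δ i n + 𝟙 (noSuffix? (window i (suc n)))
  δ-∷ʳ i n = subst (λ w → parseCount w ≡ δ i n + 𝟙 (noSuffix? w))
    (sym (window-∷ʳ i n)) (parseCount-∷ʳ (window i n) (x (i + n)))

  δ-shift : PrefixComplete → ∀ i {n} → m ≤ suc n → δ i (suc n) ≡ δ (suc i) n
  δ-shift pc i {n} le = trans
    (cong (δ (suc i) n +_) (𝟙-false (noPrefix? (window i (suc n))) (λ np → np (window-hasPrefix pc i le))))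
    (+-identityʳ _)

  δ-grow : SuffixComplete → ∀ i {n} → m ≤ suc n → δ i (suc n) ≡ δ i n
  δ-grow sc i {n} le = trans (δ-∷ʳ i n) (trans
    (cong (δ i n +_) (𝟙-false (noSuffix? (window i (suc n))) (λ ns → ns (window-hasSuffix sc i le))))
    (+-identityʳ _))

  δ-mono : ∀ i n o → δ i n ≤ δ i (n + o)
  δ-mono i n zero    = ≤-reflexive (cong (δ i) (sym (+-identityʳ n)))
  δ-mono i n (suc o) = ≤-trans (δ-mono i n o) (≤-trans (m≤m+n _ _)
    (≤-reflexive (trans (sym (δ-∷ʳ i (n + o))) (cong (δ i) (sym (+-suc n o))))))

  δ-monoˡ : ∀ i o n → δ (i + o) n ≤ δ i (o + n)
  δ-monoˡ i zero    n = ≤-reflexive (cong (λ t → δ t n) (+-identityʳ i))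
  δ-monoˡ i (suc o) n = ≤-trans (≤-reflexive (cong (λ t → δ t n) (+-suc i o)))
    (≤-trans (δ-monoˡ (suc i) o n) (m≤m+n _ _))

  δ≤ : ∀ i {n} → n ≤ m → δ i n ≤ suc m
  δ≤ i {n} le = ≤-trans (parseCount≤ (window i n)) (s≤s (subst (_≤ m) (sym (length-window i n)) le))

  -- While the length exceeds `m`, removing the first letter leaves the count unchanged; from length
  -- `m` on the crude bound by length plus one applies.
  prefixComplete⇒δ≤ : PrefixComplete → ∀ i n → δ i n ≤ suc m
  prefixComplete⇒δ≤ pc i zero    = δ≤ i z≤n
  prefixComplete⇒δ≤ pc i (suc n) with suc n ≤? m
  ... | yes le = δ≤ i le
  ... | no ¬le = subst (_≤ suc m) (sym (δ-shift pc i (≤-trans (n≤1+n m) (≰⇒> ¬le))))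
    (prefixComplete⇒δ≤ pc (suc i) n)

  suffixComplete⇒δ≤ : SuffixComplete → ∀ i n → δ i n ≤ suc m
  suffixComplete⇒δ≤ sc i zero    = δ≤ i z≤n
  suffixComplete⇒δ≤ sc i (suc n) with suc n ≤? m
  ... | yes le = δ≤ i le
  ... | no ¬le = subst (_≤ suc m) (sym (δ-grow sc i (≤-trans (n≤1+n m) (≰⇒> ¬le))))
    (suffixComplete⇒δ≤ sc i n)

  -- A window ending in `v` has no suffix in `X`, so its last letter adds a parse, and `v` recurs
  -- for ever.
  noSuffix⇒δ-unbounded : ∀ {v} → Factors x v → length v ≡ m → ¬ HasSuffixIn X v →
    ∀ r → ∃[ n ] r ≤ δ 0 n
  noSuffix⇒δ-unbounded v∈ lv ns zero = 0 , z≤n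
  noSuffix⇒δ-unbounded {v} v∈ lv ns (suc r)
    with n , r≤ ← noSuffix⇒δ-unbounded v∈ lv ns r
    -- With the new occurrence at `suc n` or later, the window still has at least `n` letters after
    -- dropping its last one, and these already give `r` parses.
    with j , v≡ ← recurrent rev v∈ (suc n) =
    suc (n + j + length v) , ≤-trans (s≤s (≤-trans r≤ (δ-mono 0 n (j + length v))))
      (≤-reflexive (trans (cong suc (cong (δ 0) (sym (+-assoc n j (length v)))))
        (sym (trans (δ-∷ʳ 0 (n + j + length v)) (trans (cong (δ 0 (n + j + length v) +_)
          (𝟙-true (noSuffix? (window 0 (suc (n + j + length v)))) ns′)) (+-comm _ 1))))))
    where
    ns′ : ¬ HasSuffixIn X (window 0 (suc (n + j + length v)))
    ns′ = subst (¬_ ∘ HasSuffixIn X)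
      (sym (trans (window-++ 0 (suc (n + j)) (length v)) (cong (window 0 (suc (n + j)) ++_) (sym v≡))))
      (noSuffix-++ (window 0 (suc (n + j))) v lv ns)

  -- The same argument from right to left. Windows now gain their first letter, so the induction has
  -- to allow every starting position `i`.
  noPrefix⇒δ-unbounded : ∀ {u} → Factors x u → length u ≡ m → ¬ HasPrefixIn X u →
    ∀ r i → ∃[ n ] r ≤ δ i n
  noPrefix⇒δ-unbounded u∈ lu np zero i = 0 , z≤n
  noPrefix⇒δ-unbounded {u} u∈ lu np (suc r) i
    with j , u≡ ← recurrent rev u∈ i
    with n , r≤ ← noPrefix⇒δ-unbounded u∈ lu np r (suc (i + j)) =
    -- The extra `length u` letters make the window starting at `i + j` contain all of `u`, however
    -- small `n` is.
    j + suc (n + length u) , ≤-trans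
      (≤-trans (s≤s (≤-trans r≤ (δ-mono (suc (i + j)) n (length u))))
        (≤-reflexive (sym (trans (cong (δ (suc (i + j)) (n + length u) +_)
          (𝟙-true (noPrefix? (window (i + j) (suc (n + length u)))) np′)) (+-comm _ 1)))))
      (δ-monoˡ i j (suc (n + length u)))
    where
    np′ : ¬ HasPrefixIn X (window (i + j) (suc (n + length u)))
    np′ = subst (¬_ ∘ HasPrefixIn X)
      (sym (trans (cong (window (i + j)) (+-comm (suc n) (length u)))
        (trans (window-++ (i + j) (length u) (suc n)) (cong (_++ window (i + j + length u) (suc n)) (sym u≡)))))
      (noPrefix-++ u (window (i + j + length u) (suc n)) lu np)

  bounded⇒≯ : ∀ {f : ℕ → ℕ} {b} → (∀ n → f n ≤ b) → ¬ (∃[ n ] b < f n)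
  bounded⇒≯ f≤ (n , lt) = <-irrefl refl (≤-trans lt (f≤ n))

  -- By `noPrefix-noSuffix-⊥`, one failure on the prefix side forces completeness on the suffix
  -- side; the count would then be both unbounded and at most `suc m`.
  prefixComplete : PrefixComplete
  prefixComplete {u} u∈ lu with hasPrefixIn? X X? u
  ... | yes p = p
  ... | no np = contradiction (noPrefix⇒δ-unbounded u∈ lu np (suc (suc m)) 0)
    (bounded⇒≯ (suffixComplete⇒δ≤ sc 0))
    where
    sc : SuffixComplete
    sc {v} v∈ lv with hasSuffixIn? X X? v
    ... | yes s = s
    ... | no ns = contradiction ns (noPrefix-noSuffix-⊥ u∈ lu np v∈ lv)

  suffixComplete : SuffixComplete
  suffixComplete {v} v∈ lv with hasSuffixIn? X X? v
  ... | yes s = s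
  ... | no ns = contradiction (noSuffix⇒δ-unbounded v∈ lv ns (suc (suc m)))
    (bounded⇒≯ (prefixComplete⇒δ≤ prefixComplete 0))

  -- A window of length `m` moves one step by gaining a letter on the right and losing one on the
  -- left; `δ-grow` and `δ-shift` show that neither changes the count.
  δ-constant : ∀ i o → δ i (m + o) ≡ δ 0 m
  δ-constant i (suc o) = trans (trans (cong (δ i) (+-suc m o))
    (δ-grow suffixComplete i (≤-trans (m≤m+n m o) (n≤1+n _)))) (δ-constant i o)
  δ-constant zero zero = cong (δ 0) (+-identityʳ m)
  δ-constant (suc i) zero = trans
    (sym (δ-shift prefixComplete i (≤-trans (m≤m+n m 0) (n≤1+n _))))
    (trans (δ-grow suffixComplete i (≤-trans (m≤m+n m 0) (n≤1+n _))) (δ-constant i zero))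

  parseCount-long : ∀ {w} → Factors x w → length w ≡ m → parseCount w ≡ δ 0 m
  parseCount-long {w} w∈ le with i , eq ← occurrence w∈ =
    trans (cong parseCount eq) (trans (cong (δ i) (trans le (sym (+-identityʳ m)))) (δ-constant i 0))

  -- Prolonging an occurrence of `w` by `m` letters on the right cannot lower the count and reaches
  -- the constant range.
  parseCount≤δ : ∀ {w} → Factors x w → parseCount w ≤ δ 0 m
  parseCount≤δ {w} w∈ with i , eq ← occurrence w∈ = ≤-trans
    (≤-reflexive (cong parseCount eq))
    (≤-trans (δ-mono i (length w) m)
      (≤-reflexive (trans (cong (δ i) (+-comm (length w) m)) (δ-constant i (length w)))))

  hasDegree : HasDegree (Factors x) X (δ 0 m)
  hasDegree = record
    { attained = window 0 m , window∈ 0 m , hasParseCount (window 0 m)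
    ; bounded  = λ {w} w∈ → parseCount w , hasParseCount w , parseCount≤δ w∈
    }

-- Counting the leaves of the prefix tree of the code.

module Counting {A : Set} (_≟_ : DecidableEquality A) (letters : List A)
  (letters! : Unique letters) (letters-complete : ∀ a → a ∈ˡ letters)
  (k : ℕ) (#letters : length letters ≡ suc k)
  (x : InfiniteWord {A}) (strict : IsStrictEpisturmian x)
  (X : Language {A}) (X? : ∀ w → Dec (X w)) (bifix : IsBifixCode X)
  (contained : ∀ {w} → X w → Factors x w) where

  open WordSums _≟_ letters letters! letters-complete
  open StrictEpisturmian _≟_ letters letters! letters-complete x strict
  open Bifix X X? bifix
  open Windows x

  -- The indicator of the internal nodes of the prefix tree of X.
  internal : List A → ℕ
  internal u = 𝟙 (factor? u) * 𝟙 (noPrefix? u)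

  -- By `noPrefix-∷ʳ`, each child of an internal node that is a factor is either internal or in `X`,
  -- never both; other nodes have no such children. `∑-extensions` counts them, with surplus `k` at
  -- the right-special word.
  children : ∀ {ℓ} u → length u ≡ ℓ →
    ∑ letters (λ a → internal (u ∷ʳ a) + 𝟙 (X? (u ∷ʳ a))) ≡
    internal u + 𝟙 (u ≟ʷ special ℓ) * (k * 𝟙 (noPrefix? (special ℓ)))
  children {ℓ} u le = begin
    ∑ letters (λ a → internal (u ∷ʳ a) + 𝟙 (X? (u ∷ʳ a)))
      ≡⟨ ∑-cong letters child ⟩
    ∑ letters (λ a → 𝟙 (factor? (u ∷ʳ a)) * np)
      ≡⟨ ∑-*ʳ letters _ np ⟩
    ∑ letters (λ a → 𝟙 (factor? (u ∷ʳ a))) * np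
      ≡⟨ cong (_* np) (∑-extensions #letters u le) ⟩
    (𝟙 (factor? u) + 𝟙 (u ≟ʷ special ℓ) * k) * np
      ≡⟨ *-distribʳ-+ np (𝟙 (factor? u)) _ ⟩
    internal u + 𝟙 (u ≟ʷ special ℓ) * k * np
      ≡⟨ cong (internal u +_) at-special ⟩
    internal u + 𝟙 (u ≟ʷ special ℓ) * (k * 𝟙 (noPrefix? (special ℓ))) ∎
    where
    open ≡-Reasoning
    np = 𝟙 (noPrefix? u)
    child : ∀ a → internal (u ∷ʳ a) + 𝟙 (X? (u ∷ʳ a)) ≡ 𝟙 (factor? (u ∷ʳ a)) * np
    child a with factor? (u ∷ʳ a)
    ... | yes _ = trans (cong (_+ 𝟙 (X? (u ∷ʳ a))) (+-identityʳ (𝟙 (noPrefix? (u ∷ʳ a)))))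
      (trans (sym (noPrefix-∷ʳ u a)) (sym (+-identityʳ np)))
    ... | no ua∉ = 𝟙-false (X? (u ∷ʳ a)) (ua∉ ∘ contained)
    at-special : 𝟙 (u ≟ʷ special ℓ) * k * np ≡ 𝟙 (u ≟ʷ special ℓ) * (k * 𝟙 (noPrefix? (special ℓ)))
    at-special with u ≟ʷ special ℓ
    ... | yes refl = *-assoc 1 k np
    ... | no _     = refl

  -- With one right-special word per length, summing `children` leaves a single surplus term.
  level : ∀ ℓ → ∑ʷ (suc ℓ) internal + ∑ʷ (suc ℓ) (𝟙 ∘ X?) ≡
    ∑ʷ ℓ internal + k * 𝟙 (noPrefix? (special ℓ))
  level ℓ = begin
    ∑ʷ (suc ℓ) internal + ∑ʷ (suc ℓ) (𝟙 ∘ X?)        ≡⟨ ∑ʷ-+ (suc ℓ) internal (𝟙 ∘ X?) ⟨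
    ∑ʷ (suc ℓ) (λ w → internal w + 𝟙 (X? w))        ≡⟨ ∑ʷ-cong ℓ children ⟩
    ∑ʷ ℓ (λ u → internal u + 𝟙 (u ≟ʷ special ℓ) * c) ≡⟨ ∑ʷ-+ ℓ _ _ ⟩
    ∑ʷ ℓ internal + ∑ʷ ℓ (λ u → 𝟙 (u ≟ʷ special ℓ) * c)
      ≡⟨ cong (∑ʷ ℓ internal +_) (trans (∑ʷ-*ʳ ℓ _ c)
           (trans (cong (_* c) (∑ʷ-𝟙 ℓ (special ℓ) (length-special ℓ))) (+-identityʳ c))) ⟩
    ∑ʷ ℓ internal + c ∎
    where
    open ≡-Reasoning
    c = k * 𝟙 (noPrefix? (special ℓ))

  parseCount-special : ∀ ℓ → parseCount (special (suc ℓ)) ≡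
    parseCount (special ℓ) + 𝟙 (noPrefix? (special (suc ℓ)))
  parseCount-special ℓ with special (suc ℓ) | special-suffix ℓ
  ... | _ | a , refl = refl

  -- Telescopes `level` from the root, which contributes the 1. The right-special words up to length
  -- `ℓ` are the suffixes of `special ℓ`, so its parse count is the number of internal ones.
  leaves : ∀ ℓ → ∑ʷ (suc ℓ) internal + ∑≤ (suc ℓ) (𝟙 ∘ X?) ≡ k * parseCount (special ℓ) + 1
  leaves zero = begin
    ∑ʷ 1 internal + (𝟙 (X? []) + ∑ʷ 1 (𝟙 ∘ X?))
      ≡⟨ cong (λ t → ∑ʷ 1 internal + (t + ∑ʷ 1 (𝟙 ∘ X?))) (𝟙-false (X? []) (IsBifixCode.nonempty bifix)) ⟩
    ∑ʷ 1 internal + ∑ʷ 1 (𝟙 ∘ X?)       ≡⟨ level 0 ⟩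
    internal [] + k * 𝟙 (noPrefix? (special 0))
      ≡⟨ cong₂ _+_ (cong₂ _*_ (𝟙-true (factor? []) (window∈ 0 0)) (𝟙-true (noPrefix? []) ¬hasPrefix[]))
           (cong (k *_) base) ⟩
    1 + k * parseCount (special 0)      ≡⟨ +-comm 1 _ ⟩
    k * parseCount (special 0) + 1      ∎
    where
    open ≡-Reasoning
    base : 𝟙 (noPrefix? (special 0)) ≡ parseCount (special 0)
    base with special 0 | length-special 0
    ... | [] | _ = 𝟙-true (noPrefix? []) ¬hasPrefix[]
  leaves (suc ℓ) = begin
    ∑ʷ (2 + ℓ) internal + (∑≤ (suc ℓ) (𝟙 ∘ X?) + ∑ʷ (2 + ℓ) (𝟙 ∘ X?))
      ≡⟨ swap (∑ʷ (2 + ℓ) internal) (∑≤ (suc ℓ) (𝟙 ∘ X?)) _ ⟩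
    (∑ʷ (2 + ℓ) internal + ∑ʷ (2 + ℓ) (𝟙 ∘ X?)) + ∑≤ (suc ℓ) (𝟙 ∘ X?)
      ≡⟨ cong (_+ ∑≤ (suc ℓ) (𝟙 ∘ X?)) (level (suc ℓ)) ⟩
    (∑ʷ (suc ℓ) internal + k * np) + ∑≤ (suc ℓ) (𝟙 ∘ X?)
      ≡⟨ swap′ (∑ʷ (suc ℓ) internal) (k * np) _ ⟩
    (∑ʷ (suc ℓ) internal + ∑≤ (suc ℓ) (𝟙 ∘ X?)) + k * np
      ≡⟨ cong (_+ k * np) (leaves ℓ) ⟩
    (k * parseCount (special ℓ) + 1) + k * np
      ≡⟨ factorise k (parseCount (special ℓ)) np ⟩
    k * (parseCount (special ℓ) + np) + 1
      ≡⟨ cong (λ t → k * t + 1) (parseCount-special ℓ) ⟨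
    k * parseCount (special (suc ℓ)) + 1 ∎
    where
    open ≡-Reasoning
    np = 𝟙 (noPrefix? (special (suc ℓ)))
    swap : ∀ a b c → a + (b + c) ≡ (a + c) + b
    swap = solve-∀
    swap′ : ∀ a b c → a + b + c ≡ a + c + b
    swap′ = solve-∀
    factorise : ∀ k p q → k * p + 1 + k * q ≡ k * (p + q) + 1
    factorise = solve-∀

-- From the leaf count to the cardinality of the code.

maxLength : ∀ {A : Set} → List (List A) → ℕ
-- The default is 1 and not 0, so that the bound is positive for every list.
maxLength []       = 1
maxLength (w ∷ ws) = length w ⊔ maxLength ws

1≤maxLength : ∀ {A : Set} (ws : List (List A)) → 1 ≤ maxLength ws
1≤maxLength []       = ≤-refl
1≤maxLength (w ∷ ws) = ≤-trans (1≤maxLength ws) (m≤n⊔m (length w) _)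

length≤maxLength : ∀ {A : Set} {ws : List (List A)} {w} → w ∈ˡ ws → length w ≤ maxLength ws
length≤maxLength {ws = w ∷ ws} (here refl) = m≤m⊔n (length w) _
length≤maxLength {ws = w ∷ ws} (there w∈)  = ≤-trans (length≤maxLength w∈) (m≤n⊔m (length w) _)

mainTheorem12 : ∀ {A : Set} (k : ℕ) → A ↔ Fin k →
    (F : Language {A}) → IsSturmianSet F →
    (X : Language {A}) (n : ℕ) → HasCard X n → IsMaximalBifixCode F X →
    ∃[ d ] HasDegree F X d × n ≡ (k ∸ 1) * d + 1
-- The infinite word supplies a letter, so the alphabet is not empty.
mainTheorem12 zero A↔ F (x , _) = case Inverse.to A↔ (x 0) of λ ()
mainTheorem12 {A} (suc k) A↔ F (x , strict , F⊆ , ⊆F) X n (ys , ys! , (ys⊆X , X⊆ys) , #ys) max =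
  _ , degree , trans (sym #ys) count
  where
  open Inverse A↔ using (to; from; strictlyInverseˡ; strictlyInverseʳ)
  to-injective : ∀ {a b} → to a ≡ to b → a ≡ b
  to-injective {a} {b} eq = trans (sym (strictlyInverseʳ a)) (trans (cong from eq) (strictlyInverseʳ b))
  from-injective : ∀ {i j} → from i ≡ from j → i ≡ j
  from-injective {i} {j} eq = trans (sym (strictlyInverseˡ i)) (trans (cong to eq) (strictlyInverseˡ j))
  _≟ᴬ_ : DecidableEquality A
  a ≟ᴬ b = map′ to-injective (cong to) (to a ≟ to b)
  letters : List A
  letters = map from (allFin (suc k))
  letters! : Unique letters
  letters! = map⁺ from-injective (allFin⁺ (suc k))
  letters-complete : ∀ a → a ∈ˡ letters
  letters-complete a = subst (_∈ˡ letters) (strictlyInverseʳ a) (∈-map⁺ from (∈-allFin (to a)))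
  #letters : length letters ≡ suc k
  #letters = trans (length-map from (allFin (suc k))) (length-tabulate {n = suc k} id)
  X? : ∀ w → Dec (X w)
  X? w = map′ ys⊆X X⊆ys (any? (≡-dec _≟ᴬ_ w) ys)
  max′ : IsMaximalBifixCode (Factors x) X
  max′ = record
    { contained   = F⊆ ∘ IsMaximalBifixCode.contained max
    ; isBifixCode = IsMaximalBifixCode.isBifixCode max
    ; maximal     = λ Y bY Y⊆ → IsMaximalBifixCode.maximal max Y bY (⊆F ∘ Y⊆)
    }
  m = maxLength ys
  open Maximal x (IsEpisturmian.reversal-closed (IsStrictEpisturmian.isEpisturmian strict))
    X X? max′ m (1≤maxLength ys) (length≤maxLength ∘ X⊆ys)
  open Bifix X X? (IsMaximalBifixCode.isBifixCode max) using (noPrefix?; parseCount)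
  open WordSums _≟ᴬ_ letters letters! letters-complete
  open StrictEpisturmian _≟ᴬ_ letters letters! letters-complete x strict
  open Counting _≟ᴬ_ letters letters! letters-complete k #letters x strict
    X X? (IsMaximalBifixCode.isBifixCode max) (IsMaximalBifixCode.contained max′)
  open Windows x
  degree : HasDegree F X (δ 0 m)
  degree = record
    { attained = let w , w∈ , c = HasDegree.attained hasDegree in w , ⊆F w∈ , c
    ; bounded  = HasDegree.bounded hasDegree ∘ F⊆
    }
  -- At this depth prefix completeness has closed every branch, so the term for internal nodes in
  -- `leaves` vanishes.
  no-internal : ∀ u → length u ≡ suc m → internal u ≡ 0
  no-internal u le with factor? u
  ... | no _   = refl
  ... | yes u∈ with i , eq ← occurrence u∈ = trans (+-identityʳ _) (𝟙-false (noPrefix? u) λ np →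
    np (subst (HasPrefixIn X) (sym eq)
      (window-hasPrefix prefixComplete i (subst (m ≤_) (sym le) (n≤1+n m)))))
  -- Sums run up to `suc m`, although the words of `X` have length at most `m`, because `leaves m`
  -- then involves `special m`, whose length is the one required by `parseCount-long`.
  count : length ys ≡ k * δ 0 m + 1
  count = begin
    length ys
      ≡⟨ ∑≤-∈ (suc m) ys! (All.tabulate (m≤n⇒m≤1+n ∘ length≤maxLength)) (λ w → map′ X⊆ys ys⊆X (X? w)) ⟨
    ∑≤ (suc m) (λ w → 𝟙 (map′ X⊆ys ys⊆X (X? w)))
      ≡⟨ ∑≤-cong (suc m) (λ w → 𝟙-cong (map′ X⊆ys ys⊆X (X? w)) (X? w) ys⊆X X⊆ys) ⟩
    ∑≤ (suc m) (𝟙 ∘ X?)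
      ≡⟨ cong (_+ ∑≤ (suc m) (𝟙 ∘ X?)) (∑ʷ-zero (suc m) no-internal) ⟨
    ∑ʷ (suc m) internal + ∑≤ (suc m) (𝟙 ∘ X?)
      ≡⟨ leaves m ⟩
    k * parseCount (special m) + 1
      ≡⟨ cong (λ t → k * t + 1) (parseCount-long (special∈ m) (length-special m)) ⟩
    k * δ 0 m + 1 ∎
    where open ≡-Reasoning
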